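{- Let $r\ge 2$ and $n\ge 2r$. A set $H\subseteq\binom{\Omega_n}{r}$ is $M_1^{(r)}$-saturated if and only if $H=H_n^{(r)}(C)$ for some $\ell\ge 1$ and some tuple $C=(w_1,\dots,w_{2\ell+1})$ of distinct vertices of $\Omega_n$ with $w_1<w_3<\dots<w_{2\ell+1}<w_2<w_4<\dots<w_{2\ell}<w_1$ and $|[w_i,w_{i-1}]|\ge r$ for all $i\in\{1,\dots,2\ell+1\}$ (indices modulo $2\ell+1$).
   Context: $\Omega_n=\{v_0,\dots,v_{n-1}\}$ carries the cyclic (clockwise) order $v_0<\dots<v_{n-1}<v_0$. A chain $x_1<\dots<x_k<x_1$ of distinct points means they appear in this clockwise cyclic order. For $a,b\in\Omega_n$, $(a,b)$ is the set of points strictly between $a$ and $b$ travelling clockwise from $a$ to $b$, and $[a,b]=(a,b)\cup\{a,b\}$. An $r$-cgh on $\Omega_n$ is a set $H\subseteq\binom{\Omega_n}{r}$. Two edges $h_1,h_2$ form a copy of $M_1^{(r)}$ if they are disjoint and there are $a,b$ with $h_1\subseteq[a,b]$ and $h_2\subseteq(b,a)$ (two geometrically disjoint $r$-sets). $H$ is $M_1^{(r)}$-saturated if no two edges of $H$ form a copy of $M_1^{(r)}$ and every $e\in\binom{\Omega_n}{r}\setminus H$ forms a copy of $M_1^{(r)}$ with some edge of $H$. For $C$ as in the claim, $H_n^{(r)}(C)=\{e\in\binom{\Omega_n}{r}: e\cap[w_i,w_{i-1}]\neq\emptyset\ \forall i\}$, indices of $w$ modulo $2\ell+1$. -}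

module Defs where

open import Data.Bool using (Bool; true; false; if_then_else_)
open import Data.Nat using (ℕ; zero; suc; _+_; _*_; _∸_; _≤ᵇ_; _<ᵇ_; _≤_; _<_)
open import Data.Nat.DivMod using (_mod_)
open import Data.Fin using (Fin; toℕ; fromℕ; inject₁) renaming (zero to fz; suc to fs)
open import Data.Fin.Subset using (Subset; _∈_; _⊆_; ∣_∣)
open import Data.Vec using (tabulate)
open import Data.Product using (_×_; Σ; ∃; ∃-syntax)
open import Data.Sum using (_⊎_)
open import Relation.Nullary using (¬_)
open import Relation.Binary.PropositionalEquality using (_≡_)
open import Function.Bundles using (_⇔_)

-- Ω_n = Fin n with v_i = i; clockwise order v_0 < v_1 < … < v_{n-1} < v_0.

cwDist : ∀ {n} → Fin n → Fin n → ℕ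
cwDist {n} a x = if toℕ a ≤ᵇ toℕ x then toℕ x ∸ toℕ a else (n + toℕ x) ∸ toℕ a

openI : ∀ {n} → Fin n → Fin n → Subset n
openI a b = tabulate (λ x → (0 <ᵇ cwDist a x) Data.Bool.∧ (cwDist a x <ᵇ cwDist a b))

closedI : ∀ {n} → Fin n → Fin n → Subset n
closedI a b = tabulate (λ x → cwDist a x ≤ᵇ cwDist a b)

Disjoint : ∀ {n} → Subset n → Subset n → Set
Disjoint h₁ h₂ = ∀ x → x ∈ h₁ → ¬ (x ∈ h₂)

M1copy : ∀ {n} → Subset n → Subset n → Set
M1copy h₁ h₂ = Disjoint h₁ h₂ × ∃[ a ] ∃[ b ] (h₁ ⊆ closedI a b × h₂ ⊆ openI b a)

FormM1 : ∀ {n} → Subset n → Subset n → Set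
FormM1 h₁ h₂ = M1copy h₁ h₂ ⊎ M1copy h₂ h₁

-- an r-cgh on Ω_n is given by its characteristic function on subsets;
-- e ∈ H  means  H e ≡ true.
Cgh : ℕ → Set
Cgh n = Subset n → Bool

IsRUniform : ∀ {n} → ℕ → Cgh n → Set
IsRUniform r H = ∀ e → H e ≡ true → ∣ e ∣ ≡ r

M1Saturated : ∀ {n} → ℕ → Cgh n → Set
M1Saturated {n} r H =
  (∀ h₁ h₂ → H h₁ ≡ true → H h₂ ≡ true → ¬ FormM1 h₁ h₂)
  × (∀ e → ∣ e ∣ ≡ r → ¬ (H e ≡ true) → ∃[ h ] (H h ≡ true × FormM1 e h))

-- tuples C = (w_1,…,w_{2ℓ+1}) are functions Fin (2ℓ+1) → Fin n, with w_{k+1} = C k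

cycPred : ∀ {m} → Fin (suc m) → Fin (suc m)
cycPred {m} fz = fromℕ m
cycPred (fs k) = inject₁ k

-- the sequence w_1, w_3, …, w_{2ℓ+1}, w_2, w_4, …, w_{2ℓ}:
-- its j-th term (0-based) is w at 0-based index 2j mod (2ℓ+1)
interleave : (ℓ : ℕ) → ℕ → Fin (suc (2 * ℓ))
interleave ℓ j = (2 * j) mod (suc (2 * ℓ))

-- C consists of distinct vertices and
-- w_1 < w_3 < … < w_{2ℓ+1} < w_2 < w_4 < … < w_{2ℓ} < w_1 (clockwise cyclic order):
-- clockwise distances from w_1 strictly increase along the sequence.
ValidC : ∀ {n} → ℕ → (ℓ : ℕ) → (Fin (suc (2 * ℓ)) → Fin n) → Set
ValidC r ℓ C =
  (∀ i j → C i ≡ C j → i ≡ j)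
  × (∀ j → suc j < suc (2 * ℓ) →
       cwDist (C fz) (C (interleave ℓ j)) < cwDist (C fz) (C (interleave ℓ (suc j))))
  × (∀ i → r ≤ ∣ closedI (C i) (C (cycPred i)) ∣)

InHC : ∀ {n} → ℕ → (ℓ : ℕ) → (Fin (suc (2 * ℓ)) → Fin n) → Subset n → Set
InHC r ℓ C e = ∣ e ∣ ≡ r × (∀ i → ∃[ x ] (x ∈ e × x ∈ closedI (C i) (C (cycPred i))))

{-# OPTIONS --safe #-}
module Submission where

-- Call an arc heavy if it contains an edge of a saturated H. Of an arc and its complement exactly one is
-- heavy: not both, since their edges would be separated; and if neither were, then every heavy arc would
-- contain an end of either one; so any r-subset, with both ends, of one having at least r points would be an edge.
-- Hence H consists of the r-sets meeting all heavy arcs. Duality makes the map K from the end of a minimal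
-- heavy arc to its start (lifted to ℕ, one turn further) satisfy K a ≤ c ⇔ a + n < K c. It follows
-- that K ∘ K moves every endpoint to the next one plus a full turn, so there are 2ℓ + 1 endpoints and K
-- advances by ℓ + 1 of them; the orbit of K is the tuple w₁, w₂, ….
-- Conversely, for any such tuple, of an arc and its complement at least one contains some [w_i, w_{i-1}],
-- and every [w_j, w_{j-1}] contains w_i or w_{i-1}.

open import Defs
open import Data.Bool using (Bool; true; false; T) renaming (_≟_ to _≟ᵇ_)
open import Data.Bool.Properties using (T-∧; T-≡)
open import Data.Nat using (ℕ; zero; suc; _+_; _*_; _∸_; _≤_; _<_; _≤ᵇ_; z≤n; s≤s; s≤s⁻¹; NonZero; _≤?_; _<?_)
open import Data.Nat.Properties
open import Algebra.Properties.CommutativeSemigroup +-commutativeSemigroup using (xy∙z≈xz∙y)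
open import Data.Nat.DivMod
open import Data.Nat.Divisibility using (n∣m*n)
open import Data.Nat.Tactic.RingSolver using (solve-∀)
open import Data.Fin using (Fin; toℕ; fromℕ) renaming (zero to fz; suc to fs)
open import Data.Fin.Properties using (toℕ-injective; toℕ-fromℕ<; toℕ<n; toℕ-fromℕ; toℕ-inject₁; all?; any?; ¬∀⟶∃¬) renaming (_≟_ to _≟ᶠ_)
open import Data.Fin.Relation.Unary.Top using (view; ‵fromℕ; ‵inject₁)
open import Data.Fin.Subset using (Subset; _∈_; _∉_; _⊆_; ∣_∣; inside; outside) renaming (⊥ to ∅)
open import Data.Fin.Subset.Properties using (_∈?_; anySubset?; p⊆q⇒∣p∣≤∣q∣; ∣⊥∣≡0; ∉⊥)
open import Data.Vec using (_∷_; tabulate; _[_]≔_; here; there)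
open import Data.Vec.Properties using (lookup∘tabulate; []=⇒lookup; lookup⇒[]=; []≔-updates; []≔-minimal; lookup∘update′)
open import Data.Product using (_×_; _,_; ∃-syntax; proj₁; proj₂)
open import Data.Sum using (_⊎_; inj₁; inj₂)
open import Data.Unit using (tt)
open import Function using (_∘_)
open import Function.Bundles using (_⇔_; mk⇔; Equivalence)
open import Relation.Nullary using (¬_; Dec; yes; no; contradiction)
open import Relation.Nullary.Decidable using (_×-dec_; _→-dec_; decidable-stable)
open import Relation.Binary.PropositionalEquality using (_≡_; refl; sym; trans; cong; cong₂; subst; subst₂; module ≡-Reasoning)

open Equivalence using (to; from)

-- Intervals, clockwise distance and insertion into subsets.

∈-tabulate : ∀ {n} {f : Fin n → Bool} {x} → x ∈ tabulate f ⇔ T (f x)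
∈-tabulate {f = f} {x} = mk⇔
  (λ x∈ → from T-≡ (trans (sym (lookup∘tabulate f x)) ([]=⇒lookup x∈)))
  (λ t → lookup⇒[]= x _ (trans (lookup∘tabulate f x) (to T-≡ t)))

∈-closedI : ∀ {n} (a b x : Fin n) → x ∈ closedI a b ⇔ cwDist a x ≤ cwDist a b
∈-closedI _ _ _ = mk⇔ (≤ᵇ⇒≤ _ _ ∘ to ∈-tabulate) (from ∈-tabulate ∘ ≤⇒≤ᵇ)

∈-openI : ∀ {n} (a b x : Fin n) → x ∈ openI a b ⇔ (0 < cwDist a x × cwDist a x < cwDist a b)
∈-openI _ _ _ = mk⇔
  (λ x∈ → let t₁ , t₂ = to T-∧ (to ∈-tabulate x∈) in <ᵇ⇒< _ _ t₁ , <ᵇ⇒< _ _ t₂)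
  (λ (p , q) → from ∈-tabulate (from T-∧ (<⇒<ᵇ p , <⇒<ᵇ q)))

cwDist-≤ : ∀ {n} {a x : Fin n} → toℕ a ≤ toℕ x → cwDist a x ≡ toℕ x ∸ toℕ a
cwDist-≤ {a = a} {x} a≤x with toℕ a ≤ᵇ toℕ x | ≤⇒≤ᵇ a≤x
... | true | _ = refl

cwDist-> : ∀ {n} {a x : Fin n} → toℕ x < toℕ a → cwDist a x ≡ (n + toℕ x) ∸ toℕ a
cwDist-> {a = a} {x} x<a with toℕ a ≤ᵇ toℕ x | ≤ᵇ⇒≤ (toℕ a) (toℕ x)
... | true  | a≤x = contradiction (a≤x tt) (<⇒≱ x<a)
... | false | _   = refl

∣insert∣ : ∀ {n} (s : Subset n) {x} → x ∉ s → ∣ s [ x ]≔ inside ∣ ≡ suc ∣ s ∣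
∣insert∣ (inside  ∷ s) {fz}   x∉s = contradiction here x∉s
∣insert∣ (outside ∷ s) {fz}   x∉s = refl
∣insert∣ (inside  ∷ s) {fs x} x∉s = cong suc (∣insert∣ s (x∉s ∘ there))
∣insert∣ (outside ∷ s) {fs x} x∉s = ∣insert∣ s (x∉s ∘ there)

∈-insert⁻ : ∀ {n} (s : Subset n) {x y} → y ∈ s [ x ]≔ inside → y ≡ x ⊎ y ∈ s
∈-insert⁻ s {x} {y} y∈ with y ≟ᶠ x
... | yes y≡x = inj₁ y≡x
... | no  y≢x = inj₂ (lookup⇒[]= y s (trans (sym (lookup∘update′ y≢x s inside)) ([]=⇒lookup y∈)))

∈-insert⁺ : ∀ {n} (s : Subset n) {x y} → y ∈ s → y ∈ s [ x ]≔ inside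
∈-insert⁺ s {x} {y} y∈s with y ≟ᶠ x
... | yes refl = []≔-updates s x
... | no  y≢x  = []≔-minimal s y x y≢x y∈s

-- Vertices are lifted to ℕ through pt, and a clockwise arc with lifted endpoints a ≤ c ≤ a + n is half-open: [a, c).
module Circle (n : ℕ) .{{_ : NonZero n}} where

  -- Vertices as residues and clockwise distance between lifts.

  pt : ℕ → Fin n
  pt x = x mod n

  toℕ-pt : ∀ x → toℕ (pt x) ≡ x % n
  toℕ-pt x = toℕ-fromℕ< (m%n<n x n)

  pt-cong-% : ∀ {x y} → x % n ≡ y % n → pt x ≡ pt y
  pt-cong-% {x} {y} eq = toℕ-injective (trans (toℕ-pt x) (trans eq (sym (toℕ-pt y))))

  pt-toℕ : ∀ x → pt (toℕ x) ≡ x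
  pt-toℕ x = toℕ-injective (trans (toℕ-pt (toℕ x)) (m<n⇒m%n≡m (toℕ<n x)))

  pt-+* : ∀ x q → pt (x + q * n) ≡ pt x
  pt-+* x q = pt-cong-% ([m+kn]%n≡m%n x q n)

  pt-+ : ∀ x → pt (x + n) ≡ pt x
  pt-+ x = pt-cong-% ([m+n]%n≡m%n x n)

  pt-congˡ : ∀ {a b} e → pt a ≡ pt b → pt (a + e) ≡ pt (b + e)
  pt-congˡ {a} {b} e eq = pt-cong-% (begin
    (a + e) % n             ≡⟨ %-distribˡ-+ a e n ⟩
    (a % n + e % n) % n     ≡⟨ cong (λ z → (z + e % n) % n) (trans (sym (toℕ-pt a)) (trans (cong toℕ eq) (toℕ-pt b))) ⟩
    (b % n + e % n) % n     ≡⟨ %-distribˡ-+ b e n ⟨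
    (b + e) % n             ∎)
    where open ≡-Reasoning

  cwDist-toℕ : ∀ {a x : Fin n} d → d < n → pt (toℕ a + d) ≡ x → cwDist a x ≡ d
  cwDist-toℕ {a} d d<n refl with toℕ a + d <? n
  ... | yes α+d<n = trans (cwDist-≤ (subst (toℕ a ≤_) (sym eq) (m≤m+n _ _)))
                          (trans (cong (_∸ toℕ a) eq) (m+n∸m≡n (toℕ a) d))
    where
    eq : toℕ (pt (toℕ a + d)) ≡ toℕ a + d
    eq = trans (toℕ-pt _) (m<n⇒m%n≡m α+d<n)
  ... | no  α+d≮n = trans (cwDist-> lt) (trans (cong (_∸ toℕ a) wrap) (m+n∸m≡n (toℕ a) d))
    where
    n≤α+d = ≮⇒≥ α+d≮n
    lt′ : toℕ a + d ∸ n < toℕ a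
    lt′ = +-cancelʳ-< n _ _ (begin-strict
      toℕ a + d ∸ n + n ≡⟨ m∸n+n≡m n≤α+d ⟩
      toℕ a + d         <⟨ +-monoʳ-< (toℕ a) d<n ⟩
      toℕ a + n         ∎)
      where open ≤-Reasoning
    eq : toℕ (pt (toℕ a + d)) ≡ toℕ a + d ∸ n
    eq = trans (toℕ-pt _) (trans (sym (m≤n⇒[n∸m]%m≡n%m n≤α+d)) (m<n⇒m%n≡m (<-trans lt′ (toℕ<n a))))
    lt : toℕ (pt (toℕ a + d)) < toℕ a
    lt = subst (_< toℕ a) (sym eq) lt′
    wrap : n + toℕ (pt (toℕ a + d)) ≡ toℕ a + d
    wrap = trans (cong (n +_) eq) (m+[n∸m]≡n n≤α+d)

  cwDist-pt : ∀ a {d} → d < n → cwDist (pt a) (pt (a + d)) ≡ d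
  cwDist-pt a {d} d<n = cwDist-toℕ d d<n (pt-congˡ d (pt-toℕ (pt a)))

  reachable : ∀ a x → ∃[ d ] (d < n × pt (a + d) ≡ x)
  reachable a x = d , m%n<n _ n , trans (pt-congˡ d (sym (pt-toℕ (pt a)))) (trans (pt-cong-% eq) (pt-toℕ x))
    where
    α = toℕ (pt a)
    -- `n ∸ α` plays the role of `- α` modulo `n`, which keeps the subtraction exact.
    d = (toℕ x + (n ∸ α)) % n
    eq : (α + d) % n ≡ toℕ x % n
    eq = begin
      (α + d) % n                              ≡⟨ %-distribˡ-+ α d n ⟩
      (α % n + d % n) % n                      ≡⟨ cong (λ z → (α % n + z) % n) (m%n%n≡m%n _ n) ⟩
      (α % n + (toℕ x + (n ∸ α)) % n) % n      ≡⟨ %-distribˡ-+ α _ n ⟨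
      (α + (toℕ x + (n ∸ α))) % n              ≡⟨ cong (_% n) (+-comm α _) ⟩
      (toℕ x + (n ∸ α) + α) % n                ≡⟨ cong (_% n) (+-assoc (toℕ x) _ α) ⟩
      (toℕ x + (n ∸ α + α)) % n                ≡⟨ cong (λ z → (toℕ x + z) % n) (m∸n+n≡m (<⇒≤ (toℕ<n (pt a)))) ⟩
      (toℕ x + n) % n                          ≡⟨ [m+n]%n≡m%n (toℕ x) n ⟩
      toℕ x % n                                ∎
      where open ≡-Reasoning

  cwDist<n : ∀ a x → cwDist a x < n
  cwDist<n a x with reachable (toℕ a) x
  ... | d , d<n , eq = subst (_< n) (sym (cwDist-toℕ d d<n eq)) d<n

  pt-cwDist : ∀ a x → pt (a + cwDist (pt a) x) ≡ x
  pt-cwDist a x with reachable a x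
  ... | d , d<n , refl = cong (λ z → pt (a + z)) (cwDist-pt a d<n)

  +-cwDist-pt : ∀ {a b} → a ≤ b → b < a + n → a + cwDist (pt a) (pt b) ≡ b
  +-cwDist-pt {a} {b} a≤b b<a+n = subst (λ z → a + cwDist (pt a) (pt z) ≡ z) (m+[n∸m]≡n a≤b)
    (cong (a +_) (cwDist-pt a (+-cancelˡ-< a _ _ (subst (_< a + n) (sym (m+[n∸m]≡n a≤b)) b<a+n))))

  -- Half-open arcs and their complements.

  OnArc : ℕ → ℕ → Fin n → Set
  OnArc a c x = ∃[ k ] (k < c × a ≤ k × pt k ≡ x)

  onArc? : ∀ a c x → Dec (OnArc a c x)
  onArc? a c x = anyUpTo? (λ k → (a ≤? k) ×-dec (pt k ≟ᶠ x)) c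

  onArc-mono : ∀ {a b c d x} → a ≤ b → c ≤ d → OnArc b c x → OnArc a d x
  onArc-mono a≤b c≤d (k , k<c , b≤k , eq) = k , <-≤-trans k<c c≤d , ≤-trans a≤b b≤k , eq

  onArc-shift : ∀ {a b} d {x} → pt a ≡ pt b → OnArc a (a + d) x → OnArc b (b + d) x
  onArc-shift {a} {b} d eq (k , k<a+d , a≤k , refl) =
    b + (k ∸ a) , +-monoʳ-< b (+-cancelˡ-< a _ _ (subst (_< a + d) (sym (m+[n∸m]≡n a≤k)) k<a+d)) , m≤m+n b _ ,
    trans (pt-congˡ (k ∸ a) (sym eq)) (cong pt (m+[n∸m]≡n a≤k))

  onArc-+* : ∀ {a c x} q → OnArc a c x → OnArc (a + q * n) (c + q * n) x
  onArc-+* q (k , k<c , a≤k , refl) = k + q * n , +-monoˡ-< _ k<c , +-monoˡ-≤ _ a≤k , pt-+* k q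

  -- On an arc of at most one turn a vertex has at most one lift, namely `a + cwDist (pt a) x`; this
  -- turns the existential `OnArc` into a single inequality.
  onArc-cwDist : ∀ {a c x} → c ≤ a + n → OnArc a c x ⇔ a + cwDist (pt a) x < c
  onArc-cwDist {a} {c} {x} c≤a+n = mk⇔
    (λ where (k , k<c , a≤k , refl) → subst (_< c) (sym (+-cwDist-pt a≤k (<-≤-trans k<c c≤a+n))) k<c)
    (λ lt → a + cwDist (pt a) x , lt , m≤m+n a _ , pt-cwDist a x)

  onArc-complement : ∀ {a c x} → c ≤ a + n → ¬ OnArc a c x → OnArc c (a + n) x
  onArc-complement {a} {c} {x} c≤a+n ¬on =
    a + cwDist (pt a) x , +-monoʳ-< a (cwDist<n (pt a) x) , ≮⇒≥ (¬on ∘ from (onArc-cwDist c≤a+n)) , pt-cwDist a x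

  onArc-disjoint : ∀ {a c x} → c ≤ a + n → OnArc a c x → ¬ OnArc c (a + n) x
  onArc-disjoint {a} {c} c≤a+n on (k , k<a+n , c≤k , refl) = <⇒≱ (to (onArc-cwDist c≤a+n) on)
    (≤-trans c≤k (≤-reflexive (sym (+-cwDist-pt (≤-trans a≤c c≤k) k<a+n))))
    where
    a≤c : a ≤ c
    a≤c = ≤-trans (m≤m+n a _) (<⇒≤ (to (onArc-cwDist c≤a+n) on))

  ∈-closedI-pt : ∀ {a b x} → a ≤ b → b < a + n → x ∈ closedI (pt a) (pt b) ⇔ OnArc a (suc b) x
  ∈-closedI-pt {a} {b} {x} a≤b b<a+n = mk⇔
    (λ x∈ → from (onArc-cwDist b<a+n) (s≤s (≤-trans (+-monoʳ-≤ a (to (∈-closedI (pt a) (pt b) x) x∈)) (≤-reflexive b≡))))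
    (λ on → from (∈-closedI (pt a) (pt b) x) (+-cancelˡ-≤ a _ _ (≤-trans (s≤s⁻¹ (to (onArc-cwDist b<a+n) on)) (≤-reflexive (sym b≡)))))
    where b≡ = +-cwDist-pt a≤b b<a+n

  ∈-openI-pt⁻ : ∀ {a b x} → a ≤ b → b < a + n → x ∈ openI (pt b) (pt a) → OnArc (suc b) (a + n) x
  ∈-openI-pt⁻ {a} {b} {x} a≤b b<a+n x∈ =
    b + cwDist (pt b) x ,
    <-≤-trans (+-monoʳ-< b (proj₂ ∈⁻)) (subst (λ z → b + cwDist (pt b) z ≤ a + n) (pt-+ a) le) ,
    m<m+n b (proj₁ ∈⁻) , pt-cwDist b x
    where
    ∈⁻ = to (∈-openI (pt b) (pt a) x) x∈
    le : b + cwDist (pt b) (pt (a + n)) ≤ a + n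
    le with m≤n⇒m<n∨m≡n a≤b
    ... | inj₁ a<b  = ≤-reflexive (+-cwDist-pt (<⇒≤ b<a+n) (+-monoˡ-< n a<b))
    ... | inj₂ refl = +-monoʳ-≤ b (<⇒≤ (cwDist<n (pt b) _))

  -- The strict inequality `a < b` matters: `openI` from a point to itself is empty, while [a + 1, a
  -- + n) holds every other vertex.
  ∈-openI-pt⁺ : ∀ {a b x} → a < b → b < a + n → OnArc (suc b) (a + n) x → x ∈ openI (pt b) (pt a)
  ∈-openI-pt⁺ {a} {b} a<b b<a+n (k , k<a+n , b<k , refl) = from (∈-openI (pt b) (pt a) (pt k))
    ( +-cancelˡ-< b _ _ (subst₂ _<_ (sym (+-identityʳ b)) (sym k≡) b<k)
    , +-cancelˡ-< b _ _ (subst₂ _<_ (sym k≡) (trans (sym a+n≡) (cong (λ z → b + cwDist (pt b) z) (pt-+ a))) k<a+n))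
    where
    a+n<b+n = +-monoˡ-< n a<b
    a+n≡ = +-cwDist-pt (<⇒≤ b<a+n) a+n<b+n
    k≡ = +-cwDist-pt (<⇒≤ b<k) (<-trans k<a+n a+n<b+n)

  -- Subsets within arcs, and counting the points of an arc.

  Within : Subset n → ℕ → ℕ → Set
  Within e a c = ∀ x → x ∈ e → OnArc a c x

  within? : ∀ e a c → Dec (Within e a c)
  within? e a c = all? λ x → (x ∈? e) →-dec onArc? a c x

  Meets : Subset n → ℕ → ℕ → Set
  Meets e a c = ∃[ x ] (x ∈ e × OnArc a c x)

  meets? : ∀ e a c → Dec (Meets e a c)
  meets? e a c = any? λ x → (x ∈? e) ×-dec onArc? a c x

  ¬meets⇒within : ∀ {e a c} → c ≤ a + n → ¬ Meets e a c → Within e c (a + n)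
  ¬meets⇒within c≤a+n ¬m x x∈e = onArc-complement c≤a+n (λ on → ¬m (x , x∈e , on))

  -- Built one point at a time, so that its size follows by induction on the length.
  arc : ℕ → ℕ → Subset n
  arc a zero    = ∅
  arc a (suc d) = arc a d [ pt (a + d) ]≔ inside

  ∈-arc⁻ : ∀ {a} d {x} → x ∈ arc a d → OnArc a (a + d) x
  ∈-arc⁻ zero x∈ = contradiction x∈ ∉⊥
  ∈-arc⁻ {a} (suc d) x∈ with ∈-insert⁻ (arc a d) x∈
  ... | inj₁ refl = a + d , ≤-reflexive (sym (+-suc a d)) , m≤m+n a d , refl
  ... | inj₂ x∈′  = onArc-mono ≤-refl (+-monoʳ-≤ a (n≤1+n d)) (∈-arc⁻ d x∈′)

  ∈-arc⁺ : ∀ {a} d {x} → OnArc a (a + d) x → x ∈ arc a d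
  ∈-arc⁺ {a} zero (k , k<a+0 , a≤k , _) = contradiction (subst (k <_) (+-identityʳ a) k<a+0) (≤⇒≯ a≤k)
  ∈-arc⁺ {a} (suc d) (k , k<a+1+d , a≤k , refl) with m≤n⇒m<n∨m≡n (s≤s⁻¹ (subst (k <_) (+-suc a d) k<a+1+d))
  ... | inj₁ k<a+d = ∈-insert⁺ (arc a d) (∈-arc⁺ d (k , k<a+d , a≤k , refl))
  ... | inj₂ refl  = []≔-updates (arc a d) (pt k)

  last∉arc : ∀ a {d e} → d ≤ e → e < n → pt (a + e) ∉ arc a d
  last∉arc a {d} {e} d≤e e<n x∈ = <⇒≱ (+-cancelˡ-< a _ _ (subst (_< a + d) (cong (a +_) (cwDist-pt a e<n))
    (to (onArc-cwDist (+-monoʳ-≤ a (≤-trans d≤e (<⇒≤ e<n)))) (∈-arc⁻ d x∈)))) d≤e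

  ∣arc∣ : ∀ a d → d ≤ n → ∣ arc a d ∣ ≡ d
  ∣arc∣ a zero    _   = ∣⊥∣≡0 n
  ∣arc∣ a (suc d) d<n = trans (∣insert∣ (arc a d) (last∉arc a ≤-refl d<n)) (cong suc (∣arc∣ a d (<⇒≤ d<n)))

  -- Such a set is contained in `arc a (c ∸ a)`, which has `c ∸ a` points; for `c < a` it would be
  -- empty, against `1 ≤ r`.
  within⇒length : ∀ {e a c r} → 1 ≤ r → ∣ e ∣ ≡ r → c ≤ a + n → Within e a c → a + r ≤ c
  within⇒length {e} {a} {c} {r} 1≤r refl c≤a+n w with a ≤? c
  ... | yes a≤c = ≤-trans (+-monoʳ-≤ a (≤-trans (p⊆q⇒∣p∣≤∣q∣ e⊆arc) (≤-reflexive (∣arc∣ a (c ∸ a) d≤n)))) (≤-reflexive c≡)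
    where
    c≡ = m+[n∸m]≡n a≤c
    d≤n : c ∸ a ≤ n
    d≤n = +-cancelˡ-≤ a _ _ (subst (_≤ a + n) (sym c≡) c≤a+n)
    e⊆arc : e ⊆ arc a (c ∸ a)
    e⊆arc {x} x∈e = ∈-arc⁺ (c ∸ a) (subst (λ z → OnArc a z x) (sym c≡) (w x x∈e))
  ... | no  a≰c = contradiction (subst (1 ≤_) (n≤0⇒n≡0 (≤-trans (p⊆q⇒∣p∣≤∣q∣ e⊆∅) (≤-reflexive (∣⊥∣≡0 n)))) 1≤r) (λ ())
    where
    e⊆∅ : e ⊆ ∅
    e⊆∅ {x} x∈e = let k , k<c , a≤k , _ = w x x∈e in contradiction (<⇒≤ (≤-<-trans a≤k k<c)) a≰c

  ∣closedI-pt∣ : ∀ {a b} → a ≤ b → b < a + n → a + ∣ closedI (pt a) (pt b) ∣ ≡ suc b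
  ∣closedI-pt∣ {a} {b} a≤b b<a+n = trans (cong (a +_) (trans (≤-antisym (p⊆q⇒∣p∣≤∣q∣ ⊆₁) (p⊆q⇒∣p∣≤∣q∣ ⊆₂)) (∣arc∣ a d d≤n))) b≡
    where
    d = suc b ∸ a
    b≡ : a + d ≡ suc b
    b≡ = m+[n∸m]≡n (m≤n⇒m≤1+n a≤b)
    d≤n : d ≤ n
    d≤n = +-cancelˡ-≤ a _ _ (subst (_≤ a + n) (sym b≡) b<a+n)
    ⊆₁ : closedI (pt a) (pt b) ⊆ arc a d
    ⊆₁ {x} x∈ = ∈-arc⁺ d (subst (λ z → OnArc a z x) (sym b≡) (to (∈-closedI-pt a≤b b<a+n) x∈))
    ⊆₂ : arc a d ⊆ closedI (pt a) (pt b)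
    ⊆₂ {x} x∈ = from (∈-closedI-pt a≤b b<a+n) (subst (λ z → OnArc a z x) b≡ (∈-arc⁻ d x∈))

  -- The witness is { a, …, a + r - 2, c - 1 }.
  edgeWithEnds : ∀ {a c r} → 2 ≤ r → a + r ≤ c → c ≤ a + n →
    ∃[ e ] (∣ e ∣ ≡ r × Within e a c × pt a ∈ e × (∀ {b} → suc b ≡ c → pt b ∈ e))
  edgeWithEnds {a} {c} {suc (suc r)} (s≤s (s≤s _)) a+r≤c c≤a+n =
    e , trans (∣insert∣ (arc a (suc r)) (last∉arc a r≤f f<n)) (cong suc (∣arc∣ a (suc r) (≤-trans r≤f (<⇒≤ f<n)))) ,
    within , ∈-insert⁺ (arc a (suc r)) (∈-arc⁺ (suc r) (a , m<m+n a (s≤s z≤n) , ≤-refl , refl)) ,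
    λ eq → subst (λ z → pt z ∈ e) (suc-injective (trans c≡ (sym eq))) ([]≔-updates (arc a (suc r)) (pt (a + f)))
    where
    f = c ∸ suc a
    c≡ : suc (a + f) ≡ c
    c≡ = m+[n∸m]≡n (≤-trans (≤-trans (s≤s (m≤m+n a _)) (≤-reflexive (sym (+-suc a _)))) a+r≤c)
    r≤f : suc r ≤ f
    r≤f = +-cancelˡ-≤ (suc a) _ _ (≤-trans (≤-reflexive (sym (+-suc a _))) (≤-trans a+r≤c (≤-reflexive (sym c≡))))
    f<n : f < n
    f<n = +-cancelˡ-< a _ _ (≤-trans (≤-reflexive c≡) c≤a+n)
    e = arc a (suc r) [ pt (a + f) ]≔ inside
    within : Within e a c
    within x x∈ with ∈-insert⁻ (arc a (suc r)) x∈
    ... | inj₁ refl = a + f , ≤-reflexive c≡ , m≤m+n a f , refl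
    ... | inj₂ x∈′  = onArc-mono ≤-refl (≤-trans (+-monoʳ-≤ a (n≤1+n _)) a+r≤c) (∈-arc⁻ (suc r) x∈′)

  -- Separation by complementary arcs, a symmetric form of `M1copy`.

  Separated : Subset n → Subset n → Set
  Separated h₁ h₂ = ∃[ a ] ∃[ c ] (a ≤ c × c ≤ a + n × Within h₁ a c × Within h₂ c (a + n))

  separated-sym : ∀ {h₁ h₂} → Separated h₁ h₂ → Separated h₂ h₁
  separated-sym (a , c , a≤c , c≤a+n , w₁ , w₂) =
    c , a + n , c≤a+n , +-monoˡ-≤ n a≤c , w₂ ,
    λ x x∈ → subst (λ z → OnArc (a + z) (c + z) x) (*-identityˡ n) (onArc-+* 1 (w₁ x x∈))

  M1copy⇒separated : ∀ {h₁ h₂} → M1copy h₁ h₂ → Separated h₁ h₂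
  M1copy⇒separated {h₁} {h₂} (_ , a , b , h₁⊆ , h₂⊆) =
    toℕ a , suc β , m≤n⇒m≤1+n α≤β , β<α+n ,
    (λ x x∈ → to (∈-closedI-pt α≤β β<α+n) (subst₂ (λ y z → x ∈ closedI y z) (sym a≡) (sym b≡) (h₁⊆ x∈))) ,
    (λ x x∈ → ∈-openI-pt⁻ α≤β β<α+n (subst₂ (λ y z → x ∈ openI y z) (sym b≡) (sym a≡) (h₂⊆ x∈)))
    where
    a≡ = pt-toℕ a
    β = toℕ a + cwDist (pt (toℕ a)) b
    b≡ : pt β ≡ b
    b≡ = pt-cwDist (toℕ a) b
    α≤β : toℕ a ≤ β
    α≤β = m≤m+n _ _
    β<α+n : β < toℕ a + n
    β<α+n = +-monoʳ-< (toℕ a) (cwDist<n (pt (toℕ a)) b)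

  formM1⇒separated : ∀ {h₁ h₂} → FormM1 h₁ h₂ → Separated h₁ h₂
  formM1⇒separated (inj₁ m) = M1copy⇒separated m
  formM1⇒separated (inj₂ m) = separated-sym (M1copy⇒separated m)

  -- Two points in `h₁` force `a < b`, so that the open interval from `pt b` to `pt a` is the whole
  -- complement and not empty.
  separated⇒M1copy : ∀ {h₁ h₂} → 2 ≤ ∣ h₁ ∣ → Separated h₁ h₂ → M1copy h₁ h₂
  separated⇒M1copy 2≤ (a , zero , a≤c , c≤a+n , w₁ , w₂) =
    contradiction (≤-trans (+-monoʳ-≤ a (≤-trans (s≤s z≤n) 2≤)) (within⇒length (≤-trans (s≤s z≤n) 2≤) refl c≤a+n w₁))
      (λ le → contradiction (subst (_≤ 0) (+-comm a 1) le) λ ())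
  separated⇒M1copy 2≤ (a , suc b , a≤c , c≤a+n , w₁ , w₂) =
    (λ x x∈₁ x∈₂ → onArc-disjoint c≤a+n (w₁ x x∈₁) (w₂ x x∈₂)) ,
    pt a , pt b ,
    (λ x∈ → from (∈-closedI-pt (<⇒≤ a<b) c≤a+n) (w₁ _ x∈)) ,
    (λ x∈ → ∈-openI-pt⁺ a<b c≤a+n (w₂ _ x∈))
    where
    a<b : a < b
    a<b = s≤s⁻¹ (≤-trans (≤-reflexive (+-comm 2 a)) (≤-trans (+-monoʳ-≤ a 2≤) (within⇒length (≤-trans (s≤s z≤n) 2≤) refl c≤a+n w₁)))

-- Strictly increasing sequences of naturals.

module StrictlyIncreasing (u : ℕ → ℕ) (u-step : ∀ k → u k < u (suc k)) where

  u-mono-≤ : ∀ {j k} → j ≤ k → u j ≤ u k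
  u-mono-≤ {j} {zero}  z≤n = ≤-refl
  u-mono-≤ {j} {suc k} j≤1+k with m≤n⇒m<n∨m≡n j≤1+k
  ... | inj₁ j<1+k = ≤-trans (u-mono-≤ (s≤s⁻¹ j<1+k)) (<⇒≤ (u-step k))
  ... | inj₂ refl  = ≤-refl

  u-mono-< : ∀ {j k} → j < k → u j < u k
  u-mono-< {j} j<k = <-≤-trans (u-step j) (u-mono-≤ j<k)

  u-cancel-< : ∀ {j k} → u j < u k → j < k
  u-cancel-< uj<uk = ≰⇒> (λ k≤j → <⇒≱ uj<uk (u-mono-≤ k≤j))

  u-injective : ∀ {j k} → u j ≡ u k → j ≡ k
  u-injective eq = ≤-antisym
    (≮⇒≥ (λ k<j → <⇒≢ (u-mono-< k<j) (sym eq)))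
    (≮⇒≥ (λ j<k → <⇒≢ (u-mono-< j<k) eq))

  k≤u : ∀ k → k ≤ u k
  k≤u zero    = z≤n
  k≤u (suc k) = ≤-<-trans (k≤u k) (u-step k)

  locate : ∀ {x} → u 0 ≤ x → ∃[ k ] (u k ≤ x × x < u (suc k))
  locate {x} u0≤x = search (suc x) (k≤u (suc x))
    where
    search : ∀ N → x < u N → ∃[ k ] (u k ≤ x × x < u (suc k))
    search zero    x<u = contradiction x<u (≤⇒≯ u0≤x)
    search (suc N) x<u with x <? u N
    ... | yes x<uN = search N x<uN
    ... | no  x≮uN = N , ≮⇒≥ x≮uN , x<u

-- K is a lifted circle map whose square is almost a full turn. On its image K ∘ K is exactly
-- "the next point of the image, one turn further", so that the image has an odd number 2ℓ + 1
-- of points per turn and K advances by ℓ + 1 of them.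
module HalfTurn (n : ℕ) (K : ℕ → ℕ)
  (K-+ : ∀ a → K (a + n) ≡ K a + n)
  (K-dual : ∀ a c → K a ≤ c ⇔ a + n < K c)
  (K-inflationary : ∀ a → a < K a) where

  KK-lower : ∀ a → a + n < K (K a)
  KK-lower a = to (K-dual a (K a)) ≤-refl

  -- By duality `K a ≤ K b` amounts to `a + n < K (K b)`, and already `b + n` is below `K (K b)`.
  K-mono : ∀ {a b} → a ≤ b → K a ≤ K b
  K-mono {a} {b} a≤b = from (K-dual a (K b)) (≤-<-trans (+-monoˡ-≤ n a≤b) (KK-lower b))

  K-below : ∀ {a c} → c < K a → K c ≤ a + n
  K-below {a} {c} c<Ka = ≮⇒≥ (λ lt → <⇒≱ c<Ka (from (K-dual a c) lt))

  -- Keeps `u` inside the image of `K`: a point that `K` sends to each term, obtained from the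
  -- previous one by `K ∘ K` with the full turn removed.
  preimage : ℕ → ℕ
  preimage zero    = 0
  preimage (suc k) = K (K (preimage k)) ∸ n

  preimage-suc : ∀ k → preimage (suc k) + n ≡ K (K (preimage k))
  preimage-suc k = m∸n+n≡m (≤-trans (m≤n+m n (preimage k)) (<⇒≤ (KK-lower (preimage k))))

  u : ℕ → ℕ
  u k = K (preimage k)

  u-suc : ∀ k → u (suc k) + n ≡ K (K (u k))
  u-suc k = trans (sym (K-+ (preimage (suc k)))) (cong K (preimage-suc k))

  u-step : ∀ k → u k < u (suc k)
  u-step k = +-cancelʳ-< n _ _ (subst (u k + n <_) (sym (u-suc k)) (KK-lower (u k)))

  open StrictlyIncreasing u u-step

  -- No image point lies strictly between two terms: `u k < K a` gives `K (u k) ≤ a + n` by duality,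
  -- and applying `K` once more gives `u (suc k) ≤ K a`.
  u-exhausts-image : ∀ a → u 0 ≤ K a → ∃[ k ] u k ≡ K a
  u-exhausts-image a u0≤ with locate u0≤
  ... | k , uk≤ , <u1+k with m≤n⇒m<n∨m≡n uk≤
  ...   | inj₂ eq  = k , eq
  ...   | inj₁ uk< = contradiction (+-cancelʳ-≤ n _ _ (begin
    u (suc k) + n ≡⟨ u-suc k ⟩
    K (K (u k))   ≤⟨ K-mono (K-below uk<) ⟩
    K (a + n)     ≡⟨ K-+ a ⟩
    K a + n       ∎)) (<⇒≱ <u1+k)
    where open ≤-Reasoning

  -- Duality at `preimage (suc k)`. Together with `K-mono` it makes `K` constant from each term up
  -- to the next.
  K-between : ∀ {k x} → x < u (suc k) → K x ≤ K (u k)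
  K-between {k} x<u = ≤-trans (K-below x<u) (≤-reflexive (preimage-suc k))

  abstract
    -- `u 0 + n` equals `K n`, an image point, and hence is a term of `u`.
    period : ∃[ m ] u m ≡ u 0 + n
    period with u-exhausts-image n (K-mono z≤n)
    ... | m , eq = m , trans eq (K-+ 0)

    halfPeriod : ∃[ s ] u s ≡ K (u 0)
    halfPeriod = u-exhausts-image (u 0) (<⇒≤ (K-inflationary (u 0)))

  m = proj₁ period
  s = proj₁ halfPeriod

  u-+m : ∀ k → u (k + m) ≡ u k + n
  u-+m zero    = proj₂ period
  u-+m (suc k) = +-cancelʳ-≡ n _ _ (begin
    u (suc (k + m)) + n ≡⟨ u-suc (k + m) ⟩
    K (K (u (k + m)))   ≡⟨ cong (K ∘ K) (u-+m k) ⟩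
    K (K (u k + n))     ≡⟨ cong K (K-+ (u k)) ⟩
    K (K (u k) + n)     ≡⟨ K-+ (K (u k)) ⟩
    K (K (u k)) + n     ≡⟨ cong (_+ n) (u-suc k) ⟨
    u (suc k) + n + n   ∎)
    where open ≡-Reasoning

  u-+s : ∀ k → u (k + s) ≡ K (u k)
  u-+s zero    = proj₂ halfPeriod
  u-+s (suc k) = +-cancelʳ-≡ n _ _ (begin
    u (suc (k + s)) + n ≡⟨ u-suc (k + s) ⟩
    K (K (u (k + s)))   ≡⟨ cong (K ∘ K) (u-+s k) ⟩
    K (K (K (u k)))     ≡⟨ cong K (u-suc k) ⟨
    K (u (suc k) + n)   ≡⟨ K-+ (u (suc k)) ⟩
    K (u (suc k)) + n   ∎)
    where open ≡-Reasoning

  -- Counts the terms passed by `K ∘ K` in two ways: two advances by `s`, or one term and a full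
  -- turn of `m`. This is why the number of endpoints is odd.
  s+s≡1+m : s + s ≡ suc m
  s+s≡1+m = u-injective (begin
    u (s + s)   ≡⟨ u-+s s ⟩
    K (u s)     ≡⟨ cong K (proj₂ halfPeriod) ⟩
    K (K (u 0)) ≡⟨ u-suc 0 ⟨
    u 1 + n     ≡⟨ u-+m 1 ⟨
    u (suc m)   ∎)
    where open ≡-Reasoning

  abstract
    odd-period : ∃[ ℓ ] (s ≡ suc ℓ × m ≡ suc (2 * ℓ))
    odd-period = go s refl
      where
      go : ∀ t → s ≡ t → ∃[ ℓ ] (s ≡ suc ℓ × m ≡ suc (2 * ℓ))
      go zero    s≡0 = contradiction (trans (cong u (sym s≡0)) (proj₂ halfPeriod)) (<⇒≢ (K-inflationary (u 0)))
      go (suc ℓ) s≡  = ℓ , s≡ , suc-injective (trans (sym s+s≡1+m) (trans (cong (λ t → t + t) s≡) (double ℓ)))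
        where
        double : ∀ ℓ → suc ℓ + suc ℓ ≡ suc (suc (2 * ℓ))
        double = solve-∀

-- Arithmetic of indices modulo an odd number.

[m%n*o]%n≡[m*o]%n : ∀ m o n .{{_ : NonZero n}} → (m % n * o) % n ≡ (m * o) % n
[m%n*o]%n≡[m*o]%n m o n = begin
  (m % n * o) % n               ≡⟨ %-distribˡ-* (m % n) o n ⟩
  (m % n % n * (o % n)) % n     ≡⟨ cong (λ z → (z * (o % n)) % n) (m%n%n≡m%n m n) ⟩
  (m % n * (o % n)) % n         ≡⟨ %-distribˡ-* m o n ⟨
  (m * o) % n                   ∎
  where open ≡-Reasoning

%-congˡ-+ : ∀ x y k n .{{_ : NonZero n}} → x % n ≡ y % n → (x + k) % n ≡ (y + k) % n
%-congˡ-+ x y k n eq = trans (%-distribˡ-+ x k n) (trans (cong (λ z → (z + k % n) % n) eq) (sym (%-distribˡ-+ y k n)))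

-- Modulo 2ℓ + 1, multiplication by ℓ + 1 is inverse to doubling.
module Halving (ℓ : ℕ) where

  m s : ℕ
  m = suc (2 * ℓ)
  s = suc ℓ

  double-half : ∀ k → 2 * k * s ≡ k + k * m
  double-half k = lemma k ℓ
    where
    lemma : ∀ k ℓ → 2 * k * suc ℓ ≡ k + k * suc (2 * ℓ)
    lemma = solve-∀

  half-interleave : ∀ k → (toℕ (interleave ℓ k) * s) % m ≡ k % m
  half-interleave k = begin
    (toℕ (interleave ℓ k) * s) % m ≡⟨ cong (λ z → (z * s) % m) (toℕ-fromℕ< (m%n<n (2 * k) m)) ⟩
    ((2 * k) % m * s) % m          ≡⟨ [m%n*o]%n≡[m*o]%n (2 * k) s m ⟩
    (2 * k * s) % m                ≡⟨ cong (_% m) (double-half k) ⟩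
    (k + k * m) % m                ≡⟨ [m+kn]%n≡m%n k k m ⟩
    k % m                          ∎
    where open ≡-Reasoning

  interleave-half : ∀ i → interleave ℓ ((toℕ i * s) % m) ≡ i
  interleave-half i = toℕ-injective (begin
    toℕ (interleave ℓ ((t * s) % m)) ≡⟨ toℕ-fromℕ< (m%n<n (2 * ((t * s) % m)) m) ⟩
    (2 * ((t * s) % m)) % m          ≡⟨ cong (_% m) (*-comm 2 ((t * s) % m)) ⟩
    ((t * s) % m * 2) % m            ≡⟨ [m%n*o]%n≡[m*o]%n (t * s) 2 m ⟩
    (t * s * 2) % m                  ≡⟨ cong (_% m) (trans (swap t s) (double-half t)) ⟩
    (t + t * m) % m                  ≡⟨ [m+kn]%n≡m%n t t m ⟩
    t % m                            ≡⟨ m<n⇒m%n≡m (toℕ<n i) ⟩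
    t                                ∎)
    where
    open ≡-Reasoning
    t = toℕ i
    swap : ∀ a b → a * b * 2 ≡ 2 * a * b
    swap = solve-∀

  cycPred-surjective : ∀ j → ∃[ i ] cycPred {2 * ℓ} i ≡ j
  cycPred-surjective j with view j
  ... | ‵fromℕ     = fz , refl
  ... | ‵inject₁ i = fs i , refl

-- C is the tuple (w₁, …, w_{2ℓ+1}) read off a lift u of w₁ < w₃ < … < w₂ < w₄ < … with period 2ℓ + 1;
-- the arc [w_i, w_{i-1}] is then [u (k + ℓ + 1), u k + n] for a suitable k.
module LiftedTuple (n : ℕ) .{{_ : NonZero n}} (ℓ : ℕ)
  (u : ℕ → ℕ) (u-step : ∀ k → u k < u (suc k))
  (u-+m : ∀ k → u (k + suc (2 * ℓ)) ≡ u k + n)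
  (C : Fin (suc (2 * ℓ)) → Fin n)
  (C≡ : ∀ i → C i ≡ Circle.pt n (u (toℕ i * suc ℓ))) where

  open Circle n
  open StrictlyIncreasing u u-step
  open Halving ℓ

  -- Positions in the periodic sequence against indices of the tuple.

  P : ℕ → Fin n
  P k = pt (u k)

  u-+* : ∀ k q → u (k + q * m) ≡ u k + q * n
  u-+* k zero    = trans (cong u (+-identityʳ k)) (sym (+-identityʳ (u k)))
  u-+* k (suc q) = begin
    u (k + (m + q * m))  ≡⟨ cong u (reorder k m (q * m)) ⟩
    u (k + q * m + m)    ≡⟨ u-+m (k + q * m) ⟩
    u (k + q * m) + n    ≡⟨ cong (_+ n) (u-+* k q) ⟩
    u k + q * n + n      ≡⟨ reorder (u k) n (q * n) ⟨
    u k + (n + q * n)    ∎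
    where
    open ≡-Reasoning
    reorder : ∀ a b c → a + (b + c) ≡ a + c + b
    reorder = solve-∀

  P-% : ∀ k → P k ≡ P (k % m)
  P-% k = begin
    pt (u k)                       ≡⟨ cong P (m≡m%n+[m/n]*n k m) ⟩
    pt (u (k % m + k / m * m))     ≡⟨ cong pt (u-+* (k % m) (k / m)) ⟩
    pt (u (k % m) + k / m * n)     ≡⟨ pt-+* (u (k % m)) (k / m) ⟩
    pt (u (k % m))                 ∎
    where open ≡-Reasoning

  P-cong-% : ∀ {j k} → j % m ≡ k % m → P j ≡ P k
  P-cong-% {j} {k} eq = trans (P-% j) (trans (cong P eq) (sym (P-% k)))

  C-interleave : ∀ k → C (interleave ℓ k) ≡ P k
  C-interleave k = trans (C≡ (interleave ℓ k)) (P-cong-% (half-interleave k))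

  -- Passing from `cycPred i` to `i` advances the position by `s`; at index 0 this closes up because
  -- `s * m` positions make whole turns.
  C≡P∘pred : ∀ i → C i ≡ P (toℕ (cycPred i) * s + s)
  C≡P∘pred fz = trans (C≡ fz) (P-cong-% (begin
    0                                       ≡⟨ m*n%n≡0 s m ⟨
    (s * m) % m                             ≡⟨ cong (_% m) (wrap ℓ) ⟩
    (2 * ℓ * s + s) % m                     ≡⟨ cong (λ t → (t * s + s) % m) (toℕ-fromℕ (2 * ℓ)) ⟨
    (toℕ (fromℕ (2 * ℓ)) * s + s) % m       ∎))
    where
    open ≡-Reasoning
    wrap : ∀ ℓ → suc ℓ * suc (2 * ℓ) ≡ 2 * ℓ * suc ℓ + suc ℓ
    wrap = solve-∀
  C≡P∘pred (fs i) = trans (C≡ (fs i)) (cong P (trans (+-comm s _) (cong (λ t → t * s + s) (sym (toℕ-inject₁ i)))))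

  arc⇒index : ∀ k → ∃[ i ] (C i ≡ P (k + s) × C (cycPred i) ≡ P k)
  arc⇒index k with cycPred-surjective (interleave ℓ k)
  ... | i , eq =
    i ,
    trans (C≡P∘pred i) (trans (cong (λ j → P (toℕ j * s + s)) eq)
      (P-cong-% (%-congˡ-+ (toℕ (interleave ℓ k) * s) k s m (half-interleave k)))) ,
    trans (cong C eq) (C-interleave k)

  index⇒arc : ∀ i → ∃[ k ] (C i ≡ P (k + s) × C (cycPred i) ≡ P k)
  index⇒arc i = toℕ (cycPred i) * s , C≡P∘pred i , C≡ (cycPred i)

  start≤end : ∀ k → u (k + s) ≤ u k + n
  start≤end k = subst (u (k + s) ≤_) (u-+m k) (u-mono-≤ (+-monoʳ-≤ k (s≤s (m≤m+n ℓ _))))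

  end<start+n : ∀ k → u k + n < u (k + s) + n
  end<start+n k = +-monoˡ-< n (u-mono-< (m<m+n k (s≤s z≤n)))

  P-arc : ∀ k {x} → x ∈ closedI (P (k + s)) (P k) ⇔ OnArc (u (k + s)) (suc (u k + n)) x
  P-arc k {x} = subst (λ z → x ∈ closedI (P (k + s)) z ⇔ OnArc (u (k + s)) (suc (u k + n)) x) (pt-+ (u k))
    (∈-closedI-pt (start≤end k) (end<start+n k))

  -- Sets meeting all generating arcs, and the saturation they give.

  Transversal : Subset n → Set
  Transversal e = ∀ k → Meets e (u (k + s)) (suc (u k + n))

  transversal⇔ : ∀ {e} → Transversal e ⇔ (∀ i → ∃[ x ] (x ∈ e × x ∈ closedI (C i) (C (cycPred i))))
  transversal⇔ {e} = mk⇔ atIndices atArcs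
    where
    atIndices : Transversal e → ∀ i → ∃[ x ] (x ∈ e × x ∈ closedI (C i) (C (cycPred i)))
    atIndices t i with index⇒arc i
    ... | k , p , q with t k
    ...   | x , x∈e , on = x , x∈e , subst₂ (λ y z → x ∈ closedI y z) (sym p) (sym q) (from (P-arc k) on)
    atArcs : (∀ i → ∃[ x ] (x ∈ e × x ∈ closedI (C i) (C (cycPred i)))) → Transversal e
    atArcs t k with arc⇒index k
    ... | i , p , q with t i
    ...   | x , x∈e , x∈ = x , x∈e , to (P-arc k) (subst₂ (λ y z → x ∈ closedI y z) p q x∈)

  Long : ℕ → Set
  Long r = ∀ k → u (k + s) + r ≤ suc (u k + n)

  ∣P-arc∣ : ∀ k → u (k + s) + ∣ closedI (P (k + s)) (P k) ∣ ≡ suc (u k + n)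
  ∣P-arc∣ k = subst (λ z → u (k + s) + ∣ closedI (P (k + s)) z ∣ ≡ suc (u k + n)) (pt-+ (u k))
    (∣closedI-pt∣ (start≤end k) (end<start+n k))

  long⇔ : ∀ {r} → Long r ⇔ (∀ i → r ≤ ∣ closedI (C i) (C (cycPred i)) ∣)
  long⇔ {r} = mk⇔ atIndices atArcs
    where
    atIndices : Long r → ∀ i → r ≤ ∣ closedI (C i) (C (cycPred i)) ∣
    atIndices l i with index⇒arc i
    ... | k , p , q = subst₂ (λ y z → r ≤ ∣ closedI y z ∣) (sym p) (sym q)
      (+-cancelˡ-≤ (u (k + s)) _ _ (≤-trans (l k) (≤-reflexive (sym (∣P-arc∣ k)))))
    atArcs : (∀ i → r ≤ ∣ closedI (C i) (C (cycPred i)) ∣) → Long r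
    atArcs l k with arc⇒index k
    ... | i , p , q =
      ≤-trans (+-monoʳ-≤ (u (k + s)) (subst₂ (λ y z → r ≤ ∣ closedI y z ∣) p q (l i))) (≤-reflexive (∣P-arc∣ k))

  cwDist-P : ∀ {k} → k < m → u 0 + cwDist (P 0) (P k) ≡ u k
  cwDist-P {k} k<m = +-cwDist-pt (u-mono-≤ z≤n) (subst (u k <_) (u-+m 0) (u-mono-< k<m))

  long⇒valid : ∀ {r} → Long r → ValidC r ℓ C
  long⇒valid l = injective , increasing , to long⇔ l
    where
    injective : ∀ i j → C i ≡ C j → i ≡ j
    injective i j Ci≡Cj = begin
      i                                ≡⟨ interleave-half i ⟨
      interleave ℓ ((toℕ i * s) % m)   ≡⟨ cong (interleave ℓ) (u-injective u≡) ⟩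
      interleave ℓ ((toℕ j * s) % m)   ≡⟨ interleave-half j ⟩
      j                                ∎
      where
      open ≡-Reasoning
      C≡P% : ∀ i → C i ≡ P ((toℕ i * s) % m)
      C≡P% i = trans (C≡ i) (P-% (toℕ i * s))
      u≡ : u ((toℕ i * s) % m) ≡ u ((toℕ j * s) % m)
      u≡ = begin
        u ((toℕ i * s) % m)                             ≡⟨ cwDist-P (m%n<n (toℕ i * s) m) ⟨
        u 0 + cwDist (P 0) (P ((toℕ i * s) % m))        ≡⟨ cong (λ x → u 0 + cwDist (P 0) x) (trans (sym (C≡P% i)) (trans Ci≡Cj (C≡P% j))) ⟩
        u 0 + cwDist (P 0) (P ((toℕ j * s) % m))        ≡⟨ cwDist-P (m%n<n (toℕ j * s) m) ⟩
        u ((toℕ j * s) % m)                             ∎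
    increasing : ∀ j → suc j < m → cwDist (C fz) (C (interleave ℓ j)) < cwDist (C fz) (C (interleave ℓ (suc j)))
    increasing j 1+j<m = subst₂ (λ x y → cwDist (C fz) x < cwDist (C fz) y) (sym (C-interleave j)) (sym (C-interleave (suc j)))
      (subst (λ z → cwDist z (P j) < cwDist z (P (suc j))) (sym (C≡ fz))
        (+-cancelˡ-< (u 0) _ _ (subst₂ _<_ (sym (cwDist-P (<-trans (n<1+n j) 1+j<m))) (sym (cwDist-P 1+j<m)) (u-step j))))

  u-pointOnArc : ∀ {h} k t → k + s ≤ t → t ≤ k + m → P t ∈ h → Meets h (u (k + s)) (suc (u k + n))
  u-pointOnArc k t k+s≤t t≤k+m Pt∈h =
    P t , Pt∈h , u t , s≤s (subst (u t ≤_) (u-+m k) (u-mono-≤ t≤k+m)) , u-mono-≤ k+s≤t , refl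

  -- Arc `j` covers the positions `j + s` to `j + m`. Let `d` be the residue of `k - j`. If `d = 0`
  -- or `s ≤ d`, the arc contains `P k`, at `j + m` or `j + d`; otherwise `d + s ≤ m` and it
  -- contains `P (k + s)`.
  ends⇒transversal : ∀ {h} k → P (k + s) ∈ h → P k ∈ h → Transversal h
  ends⇒transversal {h} k Pk+s∈h Pk∈h j = byOffset ((k + j * m ∸ j) % m) refl (m%n<n δ m)
    where
    -- Adding `j * m` keeps `k - j` nonnegative and leaves its residue unchanged.
    δ = k + j * m ∸ j
    δ+j : δ + j ≡ k + j * m
    δ+j = m∸n+n≡m (≤-trans (m≤m*n j m) (m≤n+m (j * m) k))
    congruent : ∀ d → δ % m ≡ d → (j + d) % m ≡ k % m
    congruent d refl = begin
      (j + δ % m) % m     ≡⟨ cong (_% m) (+-comm j (δ % m)) ⟩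
      (δ % m + j) % m     ≡⟨ %-congˡ-+ (δ % m) δ j m (m%n%n≡m%n δ m) ⟩
      (δ + j) % m         ≡⟨ cong (_% m) δ+j ⟩
      (k + j * m) % m     ≡⟨ [m+kn]%n≡m%n k j m ⟩
      k % m               ∎
      where open ≡-Reasoning
    P-end : ∀ d → δ % m ≡ d → P (j + d) ≡ P k
    P-end d eq = P-cong-% (congruent d eq)
    P-start : ∀ d → δ % m ≡ d → P (j + d + s) ≡ P (k + s)
    P-start d eq = P-cong-% (%-congˡ-+ (j + d) k s m (congruent d eq))
    s≤m : s ≤ m
    s≤m = s≤s (m≤m+n ℓ _)
    byOffset : ∀ d → δ % m ≡ d → d < m → Meets h (u (j + s)) (suc (u j + n))
    byOffset zero eq d<m = u-pointOnArc j (j + m) (+-monoʳ-≤ j s≤m) ≤-refl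
      (subst (_∈ h) (trans (sym (P-end 0 eq)) (P-cong-% (trans (cong (_% m) (+-identityʳ j)) (sym ([m+n]%n≡m%n j m))))) Pk∈h)
    byOffset d@(suc _) eq d<m with s ≤? d
    ... | yes s≤d = u-pointOnArc j (j + d) (+-monoʳ-≤ j s≤d) (+-monoʳ-≤ j (<⇒≤ d<m))
      (subst (_∈ h) (sym (P-end d eq)) Pk∈h)
    ... | no  s≰d = u-pointOnArc j (j + d + s) (+-monoˡ-≤ s (m≤m+n j d)) j+d+s≤
      (subst (_∈ h) (sym (P-start d eq)) Pk+s∈h)
      where
      d≤ℓ : d ≤ ℓ
      d≤ℓ = s≤s⁻¹ (≰⇒> s≰d)
      j+d+s≤ : j + d + s ≤ j + m
      j+d+s≤ = begin
        j + d + s     ≡⟨ +-assoc j d s ⟩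
        j + (d + s)   ≤⟨ +-monoʳ-≤ j (+-monoˡ-≤ s d≤ℓ) ⟩
        j + (ℓ + s)   ≡⟨ cong (j +_) (ℓ+s ℓ) ⟩
        j + m         ∎
        where
        open ≤-Reasoning
        ℓ+s : ∀ ℓ → ℓ + suc ℓ ≡ suc (2 * ℓ)
        ℓ+s = solve-∀

  -- If u (k + 1) is the first point of the sequence in [a, c), then of the arcs [u (k + 1), u (k + ℓ + 1)]
  -- and [u (k + ℓ + 1), u k + n] one lies in [a, c) or the other in [c, a + n).
  transversals-not-separated′ : ∀ {h₁ h₂} → Transversal h₁ → Transversal h₂ → ∀ {a c} → u ℓ ≤ a →
    c ≤ suc a + n → Within h₁ (suc a) c → ¬ Within h₂ c (suc a + n)
  transversals-not-separated′ t₁ t₂ {a} {c} uℓ≤a c≤ w₁ w₂ with locate (≤-trans (u-mono-≤ z≤n) uℓ≤a)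
  ... | k , uk≤a , a<u1+k with u j + n <? c
    -- Arc `j` starts at `u (suc k)`; the bound `u ℓ ≤ a` makes this subtraction exact.
    where j = k ∸ ℓ
  ... | yes uj+n<c =
    let x , x∈ , on = t₂ (k ∸ ℓ)
    in onArc-disjoint c≤ (onArc-mono (subst (λ z → suc a ≤ u z) (sym j+s) a<u1+k) uj+n<c on) (w₂ x x∈)
    where
    ℓ≤k : ℓ ≤ k
    ℓ≤k = s≤s⁻¹ (u-cancel-< (≤-<-trans uℓ≤a a<u1+k))
    j+s : k ∸ ℓ + s ≡ suc k
    j+s = trans (+-suc (k ∸ ℓ) ℓ) (cong suc (m∸n+n≡m ℓ≤k))
  ... | no  uj+n≮c =
    let x , x∈ , on = t₁ k
    in onArc-disjoint c≤ (w₁ x x∈) (onArc-mono c≤u (s≤s (+-monoˡ-≤ n uk≤a)) on)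
    where
    ℓ≤k : ℓ ≤ k
    ℓ≤k = s≤s⁻¹ (u-cancel-< (≤-<-trans uℓ≤a a<u1+k))
    rearrange : ∀ j ℓ → j + suc (2 * ℓ) ≡ j + ℓ + suc ℓ
    rearrange = solve-∀
    c≤u : c ≤ u (k + s)
    c≤u = begin
      c                    ≤⟨ ≮⇒≥ uj+n≮c ⟩
      u (k ∸ ℓ) + n        ≡⟨ u-+m (k ∸ ℓ) ⟨
      u (k ∸ ℓ + m)        ≡⟨ cong u (rearrange (k ∸ ℓ) ℓ) ⟩
      u (k ∸ ℓ + ℓ + s)    ≡⟨ cong (λ z → u (z + s)) (m∸n+n≡m ℓ≤k) ⟩
      u (k + s)            ∎
      where open ≤-Reasoning

  transversals-not-separated : ∀ {h₁ h₂} → Transversal h₁ → Transversal h₂ → ¬ Separated h₁ h₂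
  transversals-not-separated {h₁} {h₂} t₁ t₂ (a , c , a≤c , c≤a+n , w₁ , w₂) =
    transversals-not-separated′ t₁ t₂ {a + q * n ∸ 1} {c + q * n} (s≤s⁻¹ (≤-trans uℓ<a′ (≤-reflexive a′≡)))
      (≤-trans (+-monoˡ-≤ (q * n) c≤a+n) (≤-reflexive wrap))
      (λ x x∈ → subst (λ z → OnArc z (c + q * n) x) a′≡ (onArc-+* q (w₁ x x∈)))
      (λ x x∈ → subst (λ z → OnArc (c + q * n) z x) wrap (onArc-+* q (w₂ x x∈)))
    where
    -- Since `n` is positive, this many turns carry `a` beyond `u ℓ`.
    q = suc (u ℓ)
    uℓ<a′ : u ℓ < a + q * n
    uℓ<a′ = ≤-trans (m≤m*n q n) (m≤n+m (q * n) a)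
    a′≡ : a + q * n ≡ suc (a + q * n ∸ 1)
    a′≡ = sym (m+[n∸m]≡n (≤-trans (s≤s z≤n) uℓ<a′))
    wrap : a + n + q * n ≡ suc (a + q * n ∸ 1) + n
    wrap = trans (xy∙z≈xz∙y a n (q * n)) (cong (_+ n) a′≡)

  -- An r-set outside `H` misses some generating arc. That arc has room for an r-set containing both
  -- its ends, which is transversal, hence an edge, and is separated from the given set.
  long⇒saturated : ∀ {r H} → 2 ≤ r → Long r → (∀ e → H e ≡ true ⇔ InHC r ℓ C e) → M1Saturated r H
  long⇒saturated {r} {H} 2≤r long H⇔ = unseparated , saturating
    where
    edge⇒transversal : ∀ {e} → H e ≡ true → Transversal e
    edge⇒transversal {e} He = from transversal⇔ (proj₂ (to (H⇔ e) He))
    unseparated : ∀ h₁ h₂ → H h₁ ≡ true → H h₂ ≡ true → ¬ FormM1 h₁ h₂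
    unseparated h₁ h₂ H₁ H₂ f =
      transversals-not-separated (edge⇒transversal {h₁} H₁) (edge⇒transversal {h₂} H₂) (formM1⇒separated f)
    saturating : ∀ e → ∣ e ∣ ≡ r → ¬ (H e ≡ true) → ∃[ h ] (H h ≡ true × FormM1 e h)
    saturating e ∣e∣≡r ¬He
      with ¬∀⟶∃¬ m _ (λ i → any? λ x → (x ∈? e) ×-dec (x ∈? closedI (C i) (C (cycPred i))))
                     (λ all → ¬He (from (H⇔ e) (∣e∣≡r , all)))
    ... | i , ¬meets with index⇒arc i
    ...   | k , p , q with edgeWithEnds 2≤r (long k) (end<start+n k)
    ...     | h , ∣h∣≡r , h-within , start∈h , end∈h =
      h , from (H⇔ h) (∣h∣≡r , to transversal⇔ (ends⇒transversal k start∈h (subst (_∈ h) (pt-+ (u k)) (end∈h refl)))) ,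
      inj₂ (separated⇒M1copy (subst (2 ≤_) (sym ∣h∣≡r) 2≤r)
        (u (k + s) , suc (u k + n) , m≤n⇒m≤1+n (start≤end k) , end<start+n k , h-within ,
         ¬meets⇒within (end<start+n k)
           (λ (x , x∈e , on) → ¬meets (x , x∈e , subst₂ (λ y z → x ∈ closedI y z) (sym p) (sym q) (from (P-arc k) on)))))

-- Lifting a given tuple to a periodic increasing sequence.

module LiftOfTuple (n : ℕ) .{{_ : NonZero n}} (ℓ : ℕ) (C : Fin (suc (2 * ℓ)) → Fin n)
  (increasing : ∀ j → suc j < suc (2 * ℓ) →
     cwDist (C fz) (C (interleave ℓ j)) < cwDist (C fz) (C (interleave ℓ (suc j)))) where

  open Circle n
  open Halving ℓ

  -- The lift, in turn `q`, of the vertex at place `j` of the interleaved order; every turn is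
  -- measured from the first vertex of the tuple.
  w : ℕ → ℕ → ℕ
  w j q = toℕ (C fz) + cwDist (C fz) (C (interleave ℓ j)) + q * n

  u : ℕ → ℕ
  u k = w (k % m) (k / m)

  u-+* : ∀ {j} q → j < m → u (j + q * m) ≡ w j q
  u-+* {j} q j<m = cong₂ w (trans ([m+kn]%n≡m%n j q m) (m<n⇒m%n≡m j<m))
    (trans (+-distrib-/-∣ʳ j {d = m} (n∣m*n q)) (trans (cong₂ _+_ (m<n⇒m/n≡0 j<m) (m*n/n≡m q m)) refl))

  u-+m : ∀ k → u (k + m) ≡ u k + n
  u-+m k = begin
    u (k + m)                             ≡⟨ cong (λ z → u (z + m)) (m≡m%n+[m/n]*n k m) ⟩
    u (k % m + k / m * m + m)             ≡⟨ cong u (reorder (k % m) (k / m * m) m) ⟩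
    u (k % m + suc (k / m) * m)           ≡⟨ u-+* (suc (k / m)) (m%n<n k m) ⟩
    w (k % m) (suc (k / m))               ≡⟨ reorder (toℕ (C fz) + cwDist (C fz) (C (interleave ℓ (k % m)))) (k / m * n) n ⟨
    u k + n                               ∎
    where
    open ≡-Reasoning
    reorder : ∀ a b c → a + b + c ≡ a + (c + b)
    reorder = solve-∀

  u-step : ∀ k → u k < u (suc k)
  u-step k with m≤n⇒m<n∨m≡n (m%n<n k m)
  ... | inj₁ 1+j<m = subst (u k <_) (trans (sym (u-+* (k / m) 1+j<m)) (cong (u ∘ suc) (sym (m≡m%n+[m/n]*n k m))))
    (+-monoˡ-< _ (+-monoʳ-< (toℕ (C fz)) (increasing (k % m) 1+j<m)))
  -- At the end of a turn the next term is the first vertex one turn later, and each clockwise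
  -- distance is below `n`.
  ... | inj₂ 1+j≡m = subst (u k <_)
    (trans (sym (u-+* {0} (suc (k / m)) (s≤s z≤n)))
      (cong u (trans (cong (_+ k / m * m) (sym 1+j≡m)) (cong suc (sym (m≡m%n+[m/n]*n k m))))))
    (begin-strict
      w (k % m) (k / m)                       <⟨ +-monoˡ-< _ (+-monoʳ-< (toℕ (C fz)) D<n) ⟩
      toℕ (C fz) + n + k / m * n              ≡⟨ +-assoc (toℕ (C fz)) n _ ⟩
      toℕ (C fz) + suc (k / m) * n            ≤⟨ +-monoˡ-≤ (suc (k / m) * n) (m≤m+n (toℕ (C fz)) _) ⟩
      w 0 (suc (k / m))                       ∎)
    where
    open ≤-Reasoning
    D<n : cwDist (C fz) (C (interleave ℓ (k % m))) < n
    D<n = cwDist<n (C fz) _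

  C≡ : ∀ i → C i ≡ pt (u (toℕ i * suc ℓ))
  C≡ i = sym (begin
    pt (u k)                                                    ≡⟨ pt-+* _ (k / m) ⟩
    pt (toℕ (C fz) + cwDist (C fz) (C (interleave ℓ (k % m))))  ≡⟨ cong (λ z → pt (toℕ (C fz) + cwDist z (C (interleave ℓ (k % m))))) (pt-toℕ (C fz)) ⟨
    pt (toℕ (C fz) + cwDist (pt (toℕ (C fz))) (C (interleave ℓ (k % m)))) ≡⟨ pt-cwDist (toℕ (C fz)) _ ⟩
    C (interleave ℓ (k % m))                                    ≡⟨ cong C (interleave-half i) ⟩
    C i                                                         ∎)
    where
    open ≡-Reasoning
    k = toℕ i * s

+-double : ∀ a r → a + r + r ≡ a + 2 * r
+-double = solve-∀

-- Heavy arcs of a saturated family.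

module FromSaturated (r n : ℕ) (2≤r : 2 ≤ r) (2r≤n : 2 * r ≤ n) .{{_ : NonZero n}}
  (H : Cgh n) (uniform : IsRUniform r H) (saturated : M1Saturated r H) where

  open Circle n

  1≤r : 1 ≤ r
  1≤r = ≤-trans (s≤s z≤n) 2≤r

  r≤n : r ≤ n
  r≤n = ≤-trans (m≤n*m r 2) 2r≤n

  -- Heaviness of [a, c), where arcs longer than one turn are also allowed.
  Q : ℕ → ℕ → Set
  Q a c = ∃[ h ] (H h ≡ true × Within h a c)

  Q? : ∀ a c → Dec (Q a c)
  Q? a c = anySubset? λ h → (H h ≟ᵇ true) ×-dec within? h a c

  Q-mono : ∀ {a b c d} → a ≤ b → c ≤ d → Q b c → Q a d
  Q-mono a≤b c≤d (h , Hh , w) = h , Hh , λ x x∈ → onArc-mono a≤b c≤d (w x x∈)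

  Q-shift : ∀ {a b} d → pt a ≡ pt b → Q a (a + d) → Q b (b + d)
  Q-shift d eq (h , Hh , w) = h , Hh , λ x x∈ → onArc-shift d eq (w x x∈)

  Q-+* : ∀ {a c} q → Q a c → Q (a + q * n) (c + q * n)
  Q-+* q (h , Hh , w) = h , Hh , λ x x∈ → onArc-+* q (w x x∈)

  Q-+ : ∀ {a c} → Q a c → Q (a + n) (c + n)
  Q-+ {a} {c} Qac = subst (λ z → Q (a + z) (c + z)) (*-identityˡ n) (Q-+* 1 Qac)

  Q-length : ∀ {a c} → Q a c → a + r ≤ c
  Q-length {a} {c} (h , Hh , w) with c ≤? a + n
  ... | yes c≤a+n = within⇒length 1≤r (uniform h Hh) c≤a+n w
  ... | no  c≰a+n = ≤-trans (+-monoʳ-≤ a r≤n) (<⇒≤ (≰⇒> c≰a+n))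

  Q-disjoint : ∀ {a c} → Q a c → ¬ Q c (a + n)
  Q-disjoint {a} {c} Q₁@(h₁ , H₁ , w₁) Q₂@(h₂ , H₂ , w₂) =
    proj₁ saturated h₁ h₂ H₁ H₂ (inj₁ (separated⇒M1copy (subst (2 ≤_) (sym (uniform h₁ H₁)) 2≤r)
      (a , c , ≤-trans (m≤m+n a r) (Q-length Q₁) , ≤-trans (m≤m+n c r) (Q-length Q₂) , w₁ , w₂)))

  edge⇒meets : ∀ {e a c} → H e ≡ true → c ≤ a + n → Q a c → Meets e a c
  edge⇒meets {e} {a} {c} He c≤a+n Qac = decidable-stable (meets? e a c) λ ¬meets →
    Q-disjoint Qac (e , He , ¬meets⇒within c≤a+n ¬meets)

  -- A non-edge is separated from some edge, and the arc of the separation around that edge is heavy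
  -- but misses the non-edge.
  meets⇒edge : ∀ {e} → ∣ e ∣ ≡ r → (∀ {a c} → a ≤ c → Q a c → Meets e a c) → H e ≡ true
  meets⇒edge {e} ∣e∣≡r meets = decidable-stable (H e ≟ᵇ true) λ ¬He →
    let h , Hh , f = proj₂ saturated e ∣e∣≡r ¬He
        a , c , a≤c , c≤a+n , wₕ , wₑ = separated-sym (formM1⇒separated f)
        x , x∈ , on = meets a≤c (h , Hh , wₕ)
    in onArc-disjoint c≤a+n on (wₑ x x∈)

  -- An arc in Q lying in neither [a, c) nor its complement contains a or c - 1, so an r-subset of [a, c)
  -- with these two points meets every arc in Q and hence is an edge.
  arc-or-complement′ : ∀ {a c} → a + r ≤ c → c ≤ a + n → ¬ Q a c → ¬ ¬ Q c (a + n)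
  arc-or-complement′ {a} {zero} a+r≤0 _ _ _ = <⇒≱ 1≤r (≤-trans (m≤n+m r a) a+r≤0)
  arc-or-complement′ {a} {c@(suc b)} a+r≤c c≤a+n ¬Q₁ ¬Q₂ with edgeWithEnds 2≤r a+r≤c c≤a+n
  ... | e , ∣e∣≡r , within , start∈e , end∈e = ¬Q₁ (e , meets⇒edge ∣e∣≡r meetsArc , within)
    where
    module _ {x y : ℕ} (x≤y : x ≤ y) (Qxy : Q x y) where
      d = y ∸ x
      -- The heavy arc is moved by whole turns so that it starts in [a, a + n).
      x′ = a + cwDist (pt a) (pt x)
      pt≡ : pt x′ ≡ pt x
      pt≡ = pt-cwDist a (pt x)
      y≡ : x + d ≡ y
      y≡ = m+[n∸m]≡n x≤y
      Q′ : Q x′ (x′ + d)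
      Q′ = Q-shift d (sym pt≡) (subst (Q x) (sym y≡) Qxy)
      shiftedMeets : Meets e x′ (x′ + d)
      shiftedMeets with x′ + d ≤? a + n | x′ <? c | c ≤? x′ + d
      -- An arc running past `a + n` contains `pt a`.
      ... | no  y′≰ | _ | _ = pt a , start∈e , a + n , ≰⇒> y′≰ , <⇒≤ (+-monoʳ-< a (cwDist<n (pt a) (pt x))) , pt-+ a
      ... | yes y′≤ | no  x′≮c | _ = contradiction (Q-mono (≮⇒≥ x′≮c) y′≤ Q′) ¬Q₂
      ... | yes y′≤ | yes x′<c | yes c≤y′ = pt b , end∈e refl , b , c≤y′ , s≤s⁻¹ x′<c , refl
      ... | yes y′≤ | yes x′<c | no  c≰y′ = contradiction (Q-mono (m≤m+n a _) (<⇒≤ (≰⇒> c≰y′)) Q′) ¬Q₁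
      meetsArc : Meets e x y
      meetsArc with shiftedMeets
      ... | z , z∈e , on = z , z∈e , subst (λ t → OnArc x t z) y≡ (onArc-shift d pt≡ on)

  -- The complement of a full turn is empty, too short to be heavy. In particular `H` has an edge.
  Q-full : ∀ a → Q a (a + n)
  Q-full a = decidable-stable (Q? a (a + n)) λ ¬Q →
    arc-or-complement′ (+-monoʳ-≤ a r≤n) ≤-refl ¬Q λ Q₀ → <⇒≱ (m<m+n (a + n) 1≤r) (Q-length Q₀)

  -- If [a, c) has fewer than `r` points, `2 * r ≤ n` leaves at least `r` in its complement, and the
  -- previous argument is run with the two arcs exchanged.
  arc-or-complement : ∀ {a c} → ¬ Q a c → Q c (a + n)
  arc-or-complement {a} {c} ¬Q₁ with a ≤? c | a + r ≤? c
  ... | no  a≰c | _ = Q-mono ≤-refl (+-monoˡ-≤ n (<⇒≤ (≰⇒> a≰c))) (Q-full c)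
  ... | yes a≤c | yes a+r≤c = decidable-stable (Q? c (a + n)) (arc-or-complement′ a+r≤c c≤a+n ¬Q₁)
    where
    c≤a+n : c ≤ a + n
    c≤a+n = ≮⇒≥ λ a+n<c → ¬Q₁ (Q-mono ≤-refl (<⇒≤ a+n<c) (Q-full a))
  ... | yes a≤c | no  a+r≰c = decidable-stable (Q? c (a + n)) λ ¬Q₂ →
    arc-or-complement′ c+r≤a+n (+-monoˡ-≤ n a≤c) ¬Q₂ λ Q₃ →
      ¬Q₁ (subst (Q a) (m+[n∸m]≡n a≤c) (Q-shift (c ∸ a) (pt-+ a) (subst (Q (a + n)) c+n≡ Q₃)))
    where
    c+n≡ : c + n ≡ a + n + (c ∸ a)
    c+n≡ = trans (cong (_+ n) (sym (m+[n∸m]≡n a≤c))) (xy∙z≈xz∙y a (c ∸ a) n)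
    c+r≤a+n : c + r ≤ a + n
    c+r≤a+n = begin
      c + r        ≤⟨ +-monoˡ-≤ r (<⇒≤ (≰⇒> a+r≰c)) ⟩
      a + r + r    ≡⟨ +-double a r ⟩
      a + 2 * r    ≤⟨ +-monoʳ-≤ a 2r≤n ⟩
      a + n        ∎
      where open ≤-Reasoning

  -- The half-turn map of the heavy arcs and the tuple from its orbit.

  abstract
    shortest : ∀ b → ∃[ k ] (Q (suc b) (suc k) × ¬ Q (suc b) k)
    shortest b = search (suc b + n) (Q-full (suc b))
      where
      search : ∀ N → Q (suc b) N → ∃[ k ] (Q (suc b) (suc k) × ¬ Q (suc b) k)
      search zero    Q₀ = contradiction (Q-length Q₀) λ ()
      search (suc N) Q₁ with Q? (suc b) N
      ... | yes Q₀ = search N Q₀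
      ... | no ¬Q₀ = N , Q₁ , ¬Q₀

  -- The last point of the shortest arc in Q starting just after b; by duality K b - n is the
  -- first point of the shortest arc in Q ending at b.
  K : ℕ → ℕ
  K b = proj₁ (shortest b)

  Q⇔K< : ∀ {b c} → Q (suc b) c ⇔ K b < c
  Q⇔K< {b} {c} = mk⇔
    (λ Q₁ → ≰⇒> λ c≤K → proj₂ (proj₂ (shortest b)) (Q-mono ≤-refl c≤K Q₁))
    (λ K<c → Q-mono ≤-refl K<c (proj₁ (proj₂ (shortest b))))

  K-+ : ∀ b → K (b + n) ≡ K b + n
  K-+ b = ≤-antisym
    (s≤s⁻¹ (to Q⇔K< (Q-+ (from Q⇔K< ≤-refl))))
    (s≤s⁻¹ (≤-trans (+-monoˡ-≤ n (to Q⇔K< (Q-shift d (pt-+ (suc b)) (subst (Q (suc b + n)) (sym d≡) Q₁)))) (≤-reflexive d+n≡)))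
    where
    Q₁ : Q (suc b + n) (suc (K (b + n)))
    Q₁ = from Q⇔K< ≤-refl
    d = suc (K (b + n)) ∸ (suc b + n)
    d≡ : suc b + n + d ≡ suc (K (b + n))
    d≡ = m+[n∸m]≡n (≤-trans (m≤m+n _ r) (Q-length Q₁))
    d+n≡ : suc b + d + n ≡ suc (K (b + n))
    d+n≡ = trans (xy∙z≈xz∙y (suc b) d n) d≡

  -- `K a ≤ c` says that [a + 1, c + 1) is heavy, and `a + n < K c` that its complement is not.
  K-dual : ∀ a c → K a ≤ c ⇔ a + n < K c
  K-dual a c = mk⇔
    (λ Ka≤c → ≰⇒> λ Kc≤a+n → Q-disjoint (from Q⇔K< (s≤s Ka≤c)) (from Q⇔K< (s≤s Kc≤a+n)))
    (λ a+n<Kc → s≤s⁻¹ (to Q⇔K< (decidable-stable (Q? (suc a) (suc c)) λ ¬Q →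
      <⇒≱ (to Q⇔K< (arc-or-complement ¬Q)) a+n<Kc)))

  K-inflationary : ∀ b → b < K b
  K-inflationary b = <-≤-trans (m<m+n b 1≤r) (s≤s⁻¹ (Q-length (from (Q⇔K< {b}) ≤-refl)))

  open HalfTurn n K K-+ K-dual K-inflationary
  open StrictlyIncreasing u u-step

  ℓ : ℕ
  ℓ = proj₁ odd-period

  u-+1+ℓ : ∀ k → u (k + suc ℓ) ≡ K (u k)
  u-+1+ℓ k = trans (cong (λ t → u (k + t)) (sym (proj₁ (proj₂ odd-period)))) (u-+s k)

  u-+1+2ℓ : ∀ k → u (k + suc (2 * ℓ)) ≡ u k + n
  u-+1+2ℓ k = trans (cong (λ t → u (k + t)) (sym (proj₂ (proj₂ odd-period)))) (u-+m k)

  C : Fin (suc (2 * ℓ)) → Fin n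
  C i = pt (u (toℕ i * suc ℓ))

  open LiftedTuple n ℓ u u-step u-+1+2ℓ C (λ _ → refl)

  -- [u k + 1, K (u k)) stops one point short of being heavy, so its complement is heavy; that
  -- complement starts at `K (u k)`, which is `u (k + suc ℓ)`.
  Q-generator : ∀ k → Q (u (k + suc ℓ)) (suc (u k + n))
  Q-generator k = arc-or-complement λ Q₁ → <⇒≢ (to Q⇔K< Q₁) (sym (u-+1+ℓ k))

  generators-long : Long r
  generators-long k = Q-length (Q-generator k)

  edge⇒transversal : ∀ {e} → H e ≡ true → Transversal e
  edge⇒transversal He k = edge⇒meets He (end<start+n k) (Q-generator k)

  -- The complement [b + 1, a) of the heavy arc is not heavy, so `a ≤ K b`; for the last term
  -- `u k ≤ b`, `K-between` turns this into a bound by the start of generator `k`.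
  Q-contains-generator : ∀ {a b} → u 0 ≤ b → Q a (suc b + n) →
    ∃[ k ] (a ≤ u (k + suc ℓ) × suc (u k + n) ≤ suc b + n)
  Q-contains-generator {a} {b} u0≤b Q₁ = around (locate u0≤b)
    where
    around : ∃[ k ] (u k ≤ b × b < u (suc k)) → ∃[ k ] (a ≤ u (k + suc ℓ) × suc (u k + n) ≤ suc b + n)
    around (k , uk≤b , b<u1+k) = k , a≤ , s≤s (+-monoˡ-≤ n uk≤b)
      where
      a≤ : a ≤ u (k + suc ℓ)
      a≤ = begin
        a               ≤⟨ ≮⇒≥ (λ K<a → Q-disjoint (from Q⇔K< K<a) Q₁) ⟩
        K b             ≤⟨ K-between {k} b<u1+k ⟩
        K (u k)         ≡⟨ u-+1+ℓ k ⟨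
        u (k + suc ℓ)   ∎
        where open ≤-Reasoning

  transversal⇒meets : ∀ {e a c} → Transversal e → a ≤ c → Q a c → Meets e a c
  transversal⇒meets {e} {a} {c} t a≤c Qac =
    fromGenerator (Q-contains-generator u0≤b (subst (Q (a + suc q * n)) (sym b≡) (Q-+* (suc q) Qac)))
    where
    -- Of the `suc q` turns added, `q` bring the end past `u 0`, and one makes up for the `n`
    -- subtracted in `b`.
    q = suc (u 0)
    u0+1+n≤ : u 0 + suc n ≤ c + suc q * n
    u0+1+n≤ = begin
      u 0 + suc n           ≡⟨ +-suc (u 0) n ⟩
      q + n                 ≡⟨ +-comm q n ⟩
      n + q                 ≤⟨ +-monoʳ-≤ n (m≤m*n q n) ⟩
      suc q * n             ≤⟨ m≤n+m (suc q * n) c ⟩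
      c + suc q * n         ∎
      where open ≤-Reasoning
    b = c + suc q * n ∸ suc n
    b≡ : suc b + n ≡ c + suc q * n
    b≡ = trans (sym (+-suc b n)) (m∸n+n≡m (≤-trans (m≤n+m (suc n) (u 0)) u0+1+n≤))
    u0≤b : u 0 ≤ b
    u0≤b = m+n≤o⇒m≤o∸n (u 0) u0+1+n≤
    c≡ : suc b + n ≡ a + suc q * n + (c ∸ a)
    c≡ = trans b≡ (trans (cong (_+ suc q * n) (sym (m+[n∸m]≡n a≤c))) (xy∙z≈xz∙y a (c ∸ a) (suc q * n)))
    fromGenerator : ∃[ k ] (a + suc q * n ≤ u (k + suc ℓ) × suc (u k + n) ≤ suc b + n) → Meets e a c
    fromGenerator (k , a≤ , ≤c) =
      let x , x∈e , on = t k
      in x , x∈e , subst (λ z → OnArc a z x) (m+[n∸m]≡n a≤c)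
           (onArc-shift (c ∸ a) (pt-+* a (suc q)) (onArc-mono a≤ (≤-trans ≤c (≤-reflexive c≡)) on))

  edge⇔ : ∀ e → H e ≡ true ⇔ InHC r ℓ C e
  edge⇔ e = mk⇔
    (λ He → uniform e He , to transversal⇔ (edge⇒transversal He))
    (λ (∣e∣≡r , t) → meets⇒edge ∣e∣≡r (transversal⇒meets (from transversal⇔ t)))

  valid : ValidC r ℓ C
  valid = long⇒valid generators-long

  -- For `ℓ = 0` a generating arc would be a single vertex, with no room for `r ≥ 2` points.
  1≤ℓ : 1 ≤ ℓ
  1≤ℓ = n≢0⇒n>0 λ ℓ≡0 → <⇒≱ 2≤r (+-cancelˡ-≤ (u (suc ℓ)) _ _ (begin
    u (suc ℓ) + r            ≤⟨ generators-long 0 ⟩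
    suc (u 0 + n)            ≡⟨ cong suc (u-+1+2ℓ 0) ⟨
    suc (u (suc (2 * ℓ)))    ≡⟨ cong (λ t → suc (u (suc t))) (trans (cong (2 *_) ℓ≡0) (sym ℓ≡0)) ⟩
    suc (u (suc ℓ))          ≡⟨ +-comm 1 (u (suc ℓ)) ⟩
    u (suc ℓ) + 1            ∎))
    where open ≤-Reasoning

theorem3p2 : (r n : ℕ) → 2 ≤ r → 2 * r ≤ n → (H : Cgh n) → IsRUniform r H →
    M1Saturated r H ⇔
    (∃[ ℓ ] ∃[ C ] (1 ≤ ℓ × ValidC r ℓ C × (∀ e → (H e ≡ true) ⇔ InHC r ℓ C e)))
theorem3p2 r zero 2≤r 2r≤n = contradiction (≤-trans 2≤r (≤-trans (m≤n*m r 2) 2r≤n)) λ ()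
theorem3p2 r n@(suc _) 2≤r 2r≤n H uniform = mk⇔ forward backward
  where
  forward : M1Saturated r H → ∃[ ℓ ] ∃[ C ] (1 ≤ ℓ × ValidC r ℓ C × (∀ e → (H e ≡ true) ⇔ InHC r ℓ C e))
  forward saturated = ℓ , C , 1≤ℓ , valid , edge⇔
    where open FromSaturated r n 2≤r 2r≤n H uniform saturated
  backward : ∃[ ℓ ] ∃[ C ] (1 ≤ ℓ × ValidC r ℓ C × (∀ e → (H e ≡ true) ⇔ InHC r ℓ C e)) → M1Saturated r H
  backward (ℓ , C , _ , (_ , increasing , long) , H⇔) = long⇒saturated 2≤r (from long⇔ long) H⇔
    where
    open LiftOfTuple n ℓ C increasing
    open LiftedTuple n ℓ u u-step u-+m C C≡
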